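{- Let $V$ be a finite set. A mapping $(u,v)\mapsto [uv]$ from $V^2$ to $2^V$ satisfies the three conditions (S) for all $a,b,c\in V$ there exists $d\in V$ such that $[ab]\cap [bc]=[bd]$; (T) for all $a,b,c\in V$: if $[ab]\subseteq [ac]$, then $[ab]\cap [bc]=\{b\}$; (U$_1$) for all $a,b,c\in V$: if $[ab]\cap [bc]=\{b\}$, then $[ab]\cup [bc]=[ac]$; if and only if there is a tree $T$ with vertex set $V$ such that $[vw]_T=[vw]$ for all pairs $v,w$ of its vertices.
   Context: A tree is a finite, simple, undirected, connected graph without cycles. $2^V$ denotes the set of all subsets of $V$. The value of the mapping at the ordered pair $(u,v)$ is denoted $[uv]$ (no symmetry is assumed a priori, and $u=v$ is allowed). For vertices $u,v$ (not necessarily distinct) of a tree $T$, $[uv]_T$ denotes the set of all vertices on the path in $T$ that joins $u$ and $v$, including $u$ and $v$ themselves (so $[uu]_T=\{u\}$). -}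

module Defs where

open import Level using (0ℓ)
open import Data.Nat using (ℕ; _≤_)
open import Data.Fin using (Fin)
open import Data.Fin.Subset using (Subset; _∩_; _∪_; _⊆_; ⁅_⁆; ⋃)
open import Data.List using (List; []; _∷_; length; map)
open import Data.List.Relation.Unary.Unique.Propositional using (Unique)
open import Data.Product using (Σ; ∃-syntax; _×_; proj₁)
open import Relation.Nullary using (¬_)
open import Relation.Binary.Core using (Rel)
open import Relation.Binary.Definitions using (Decidable; Irreflexive; Symmetric)
open import Relation.Binary.Construct.Closure.ReflexiveTransitive using (Star; ε; _◅_)
open import Relation.Binary.PropositionalEquality using (_≡_)

record SimpleGraph (n : ℕ) : Set₁ where
  field
    Adj    : Rel (Fin n) 0ℓ
    adj?   : Decidable Adj
    sym    : Symmetric Adj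
    irrefl : Irreflexive _≡_ Adj

module _ {n : ℕ} (G : SimpleGraph n) where
  open SimpleGraph G

  Walk : Rel (Fin n) 0ℓ
  Walk = Star Adj

  vertices : ∀ {u v} → Walk u v → List (Fin n)
  vertices {u} ε       = u ∷ []
  vertices {u} (_ ◅ w) = u ∷ vertices w

  Path : Rel (Fin n) 0ℓ
  Path u v = Σ (Walk u v) λ w → Unique (vertices w)

  Connected : Set
  Connected = ∀ u v → Path u v

  -- A cycle is a path on at least three vertices together with an edge
  -- joining its last vertex to its first.
  Cycle : Set
  Cycle = ∃[ u ] ∃[ v ] Σ (Path u v) λ p →
            3 ≤ length (vertices (proj₁ p)) × Adj v u

  Acyclic : Set
  Acyclic = ¬ Cycle

-- The graph on Fin 0 counts as a tree.
record Tree (n : ℕ) : Set₁ where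
  field
    graph     : SimpleGraph n
    connected : Connected graph
    acyclic   : Acyclic graph

-- By acyclicity there is only one path from u to v, so the set does not
-- depend on which path `connected` supplies.
interval : ∀ {n} → Tree n → Fin n → Fin n → Subset n
interval T u v = ⋃ (map ⁅_⁆ (vertices graph (proj₁ (connected u v))))
  where open Tree T

module _ {n : ℕ} (I : Fin n → Fin n → Subset n) where

  ConditionS : Set
  ConditionS = ∀ a b c → ∃[ d ] I a b ∩ I b c ≡ I b d

  ConditionT : Set
  ConditionT = ∀ a b c → I a b ⊆ I a c → I a b ∩ I b c ≡ ⁅ b ⁆

  ConditionU₁ : Set
  ConditionU₁ = ∀ a b c → I a b ∩ I b c ≡ ⁅ b ⁆ → I a b ∪ I b c ≡ I a c

{-# OPTIONS --safe #-}

-- (⇒) Conditions S, T and U₁ make I symmetric, with I a b = I a d ∪ I d b and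
-- I a d ∩ I d b = {d} whenever d ∈ I a b.  Join u and v when I u v has no
-- vertex besides u ≠ v.  Walking along I u v gives a path between any two
-- vertices.  Conversely, by induction with U₁, the vertices of any path from
-- u to v are exactly I u v; so a path of length at least two cannot join
-- adjacent vertices, and the graph has no cycles.
--
-- (⇐) In an acyclic graph, a path from u that visits a neighbour w of u must
-- step to w first (otherwise it closes a cycle); hence, by induction on one of
-- them, two paths with the same ends agree.  Given unique paths, T comes from
-- splitting the path from a to c at b, and U₁ from concatenating paths that
-- meet only in b; for S, follow the path from a to b up to its first vertex d
-- on the path from b to c.
module Submission where

open import Defs
open import Data.Empty using (⊥-elim)
open import Data.Nat using (ℕ; _≤_; z≤n; s≤s)
open import Data.Fin using (Fin)
open import Data.Fin.Properties using (_≟_; any?; all?)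
open import Data.Fin.Subset using (Subset; _∈_; _⊆_; _⊂_; _∩_; _∪_; ⁅_⁆; ⋃)
open import Data.Fin.Subset.Induction using (Acc; acc; ⊂-wellFounded)
open import Data.Fin.Subset.Properties
  using (_∈?_; ∉⊥; x∈⁅x⁆; x∈⁅y⁆⇒x≡y; ⊆-antisym; x∈p∩q⁺; x∈p∩q⁻; x∈p∪q⁺; x∈p∪q⁻; ∩-idem;
         ∪-identityʳ)
open import Data.List using (List; []; _∷_; length; map)
open import Data.List.Membership.Propositional using () renaming (_∈_ to _∈ₗ_; _∉_ to _∉ₗ_)
open import Data.List.Membership.DecPropositional using () renaming (_∈?_ to member?)
open import Data.List.Relation.Unary.All.Properties using (¬Any⇒All¬; All¬⇒¬Any)
open import Data.List.Relation.Unary.AllPairs using ([]; _∷_)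
open import Data.List.Relation.Unary.Any using (here; there)
open import Data.List.Relation.Unary.Unique.Propositional using (Unique)
open import Data.Product using (Σ; ∃-syntax; _×_; _,_; proj₁; proj₂)
open import Data.Sum using (_⊎_; inj₁; inj₂; [_,_]′)
open import Function.Base using (_∘_)
open import Function.Bundles using (_⇔_; mk⇔)
open import Relation.Nullary using (¬_; yes; no; contradiction)
open import Relation.Nullary.Decidable using (¬?; _×-dec_; _⊎-dec_; _→-dec_)
open import Relation.Binary.Construct.Closure.ReflexiveTransitive using (ε; _◅_; _◅◅_)
open import Relation.Binary.PropositionalEquality
  using (_≡_; _≢_; refl; sym; trans; cong; subst)

private
  variable
    n : ℕ

-- Unions of singletons and duplicate-free lists.

∈-⋃-singletons⁺ : ∀ {x : Fin n} {xs} → x ∈ₗ xs → x ∈ ⋃ (map ⁅_⁆ xs)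
∈-⋃-singletons⁺ (here refl)  = x∈p∪q⁺ (inj₁ (x∈⁅x⁆ _))
∈-⋃-singletons⁺ (there x∈xs) = x∈p∪q⁺ (inj₂ (∈-⋃-singletons⁺ x∈xs))

∈-⋃-singletons⁻ : ∀ {x : Fin n} xs → x ∈ ⋃ (map ⁅_⁆ xs) → x ∈ₗ xs
∈-⋃-singletons⁻ []       x∈ = contradiction x∈ ∉⊥
∈-⋃-singletons⁻ (y ∷ ys) x∈ with x∈p∪q⁻ ⁅ y ⁆ _ x∈
... | inj₁ x∈y  = here (x∈⁅y⁆⇒x≡y y x∈y)
... | inj₂ x∈ys = there (∈-⋃-singletons⁻ ys x∈ys)

∩≡⁅⁆⁺ : ∀ {p q : Subset n} {b} → b ∈ p → b ∈ q →
        (∀ {x} → x ∈ p → x ∈ q → x ≡ b) → p ∩ q ≡ ⁅ b ⁆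
∩≡⁅⁆⁺ {p = p} {q} {b} b∈p b∈q meet = ⊆-antisym
  (λ x∈ → let x∈p , x∈q = x∈p∩q⁻ p q x∈ in
          subst (_∈ ⁅ b ⁆) (sym (meet x∈p x∈q)) (x∈⁅x⁆ b))
  (λ x∈ → subst (_∈ p ∩ q) (sym (x∈⁅y⁆⇒x≡y b x∈)) (x∈p∩q⁺ (b∈p , b∈q)))

∩≡⁅⁆⁻ : ∀ {p q : Subset n} {b x} → p ∩ q ≡ ⁅ b ⁆ → x ∈ p → x ∈ q → x ≡ b
∩≡⁅⁆⁻ {b = b} eq x∈p x∈q = x∈⁅y⁆⇒x≡y b (subst (_ ∈_) eq (x∈p∩q⁺ (x∈p , x∈q)))

∷-unique⁺ : ∀ {x : Fin n} {xs} → x ∉ₗ xs → Unique xs → Unique (x ∷ xs)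
∷-unique⁺ x∉xs uniq = ¬Any⇒All¬ _ x∉xs ∷ uniq

∷-unique⁻ : ∀ {x : Fin n} {xs} → Unique (x ∷ xs) → x ∉ₗ xs × Unique xs
∷-unique⁻ (x≢xs ∷ uniq) = All¬⇒¬Any x≢xs , uniq

-- Concatenating and splitting walks.

module Walks (G : SimpleGraph n) where
  open SimpleGraph G using (Adj; irrefl) renaming (sym to Adj-sym)

  private
    V : ∀ {u v} → Walk G u v → List (Fin n)
    V = vertices G

  source∈ : ∀ {u v} (p : Walk G u v) → u ∈ₗ V p
  source∈ ε       = here refl
  source∈ (_ ◅ _) = here refl

  target∈ : ∀ {u v} (p : Walk G u v) → v ∈ₗ V p
  target∈ ε       = here refl
  target∈ (_ ◅ p) = there (target∈ p)

  length-vertices≥1 : ∀ {u v} (p : Walk G u v) → 1 ≤ length (V p)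
  length-vertices≥1 ε       = s≤s z≤n
  length-vertices≥1 (_ ◅ _) = s≤s z≤n

  ∈-◅◅⁺ˡ : ∀ {u x v y} (r : Walk G u x) (s : Walk G x v) → y ∈ₗ V r → y ∈ₗ V (r ◅◅ s)
  ∈-◅◅⁺ˡ ε       s (here refl) = source∈ s
  ∈-◅◅⁺ˡ (_ ◅ r) s (here eq)   = here eq
  ∈-◅◅⁺ˡ (_ ◅ r) s (there y∈)  = there (∈-◅◅⁺ˡ r s y∈)

  ∈-◅◅⁺ʳ : ∀ {u x v y} (r : Walk G u x) (s : Walk G x v) → y ∈ₗ V s → y ∈ₗ V (r ◅◅ s)
  ∈-◅◅⁺ʳ ε       s y∈ = y∈
  ∈-◅◅⁺ʳ (_ ◅ r) s y∈ = there (∈-◅◅⁺ʳ r s y∈)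

  ∈-◅◅⁻ : ∀ {u x v y} (r : Walk G u x) (s : Walk G x v) →
          y ∈ₗ V (r ◅◅ s) → y ∈ₗ V r ⊎ y ∈ₗ V s
  ∈-◅◅⁻ ε       s y∈          = inj₂ y∈
  ∈-◅◅⁻ (_ ◅ r) s (here eq)   = inj₁ (here eq)
  ∈-◅◅⁻ (_ ◅ r) s (there y∈) with ∈-◅◅⁻ r s y∈
  ... | inj₁ y∈r = inj₁ (there y∈r)
  ... | inj₂ y∈s = inj₂ y∈s

  ◅◅-unique⁺ : ∀ {u x v} (r : Walk G u x) (s : Walk G x v) →
               Unique (V r) → Unique (V s) →
               (∀ {y} → y ∈ₗ V r → y ∈ₗ V s → y ≡ x) → Unique (V (r ◅◅ s))
  ◅◅-unique⁺ ε       s _ us _    = us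
  ◅◅-unique⁺ (_ ◅ r) s ur us meet with ∷-unique⁻ ur
  ... | u∉r , ur′ = ∷-unique⁺
    -- If `u` were on `s`, it would be the common vertex `x`, which is the target of `r`.
    (λ u∈ → [ u∉r , (λ u∈s → u∉r (subst (_∈ₗ V r) (sym (meet (here refl) u∈s)) (target∈ r))) ]′
              (∈-◅◅⁻ r s u∈))
    (◅◅-unique⁺ r s ur′ us (meet ∘ there))

  ◅◅-unique⁻ : ∀ {u x v} (r : Walk G u x) (s : Walk G x v) → Unique (V (r ◅◅ s)) →
               Unique (V r) × Unique (V s) × (∀ {y} → y ∈ₗ V r → y ∈ₗ V s → y ≡ x)
  ◅◅-unique⁻ ε       s us = (∷-unique⁺ (λ ()) []) , us , λ { (here eq) _ → eq }
  ◅◅-unique⁻ (_ ◅ r) s uniq with ∷-unique⁻ uniq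
  ... | u∉ , uniq′ with ◅◅-unique⁻ r s uniq′
  ... | ur , us , meet =
    ∷-unique⁺ (u∉ ∘ ∈-◅◅⁺ˡ r s) ur , us ,
    λ { (here refl) y∈s → contradiction (∈-◅◅⁺ʳ r s y∈s) u∉
      ; (there y∈r) y∈s → meet y∈r y∈s }

  splitAt : ∀ {u v x} (p : Walk G u v) → x ∈ₗ V p →
            Σ (Walk G u x) λ r → Σ (Walk G x v) λ s → p ≡ r ◅◅ s
  splitAt ε       (here refl) = ε , ε , refl
  splitAt (e ◅ p) (here refl) = ε , e ◅ p , refl
  splitAt (e ◅ p) (there x∈) with splitAt p x∈
  ... | r , s , refl = e ◅ r , s , refl

  -- Uniqueness of paths in an acyclic graph.

  module _ (acyclic : Acyclic G) where

    path-through-neighbour : ∀ {u v w} → Adj w u → (p : Walk G u v) → Unique (V p) →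
                             w ∈ₗ V p → Σ (Walk G w v) λ q → V p ≡ u ∷ V q × Unique (V q)
    path-through-neighbour e ε       _    (here refl) = ⊥-elim (irrefl refl e)
    path-through-neighbour e (_ ◅ _) _    (here refl) = ⊥-elim (irrefl refl e)
    path-through-neighbour e (f ◅ p) uniq (there w∈) with splitAt p w∈
    ... | ε , s , refl = s , refl , proj₂ (∷-unique⁻ uniq)
    -- The piece of the path up to `w` has at least two edges here, so `e` closes it to a cycle.
    ... | g ◅ r , s , refl = ⊥-elim (acyclic
      (_ , _ , (f ◅ g ◅ r , proj₁ (◅◅-unique⁻ (f ◅ g ◅ r) s uniq))
         , s≤s (s≤s (length-vertices≥1 r)) , e))

    path-unique : ∀ {u v} (p q : Walk G u v) → Unique (V p) → Unique (V q) → V p ≡ V q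
    path-unique ε       ε       _  _  = refl
    path-unique ε       (_ ◅ q) _  uq = contradiction (target∈ q) (proj₁ (∷-unique⁻ uq))
    path-unique (_ ◅ p) ε       up _  = contradiction (target∈ p) (proj₁ (∷-unique⁻ up))
    path-unique {u} (_◅_ {j = w} e p) q@(_ ◅ _) up uq with ∷-unique⁻ up
    ... | u∉p , up′ with member? _≟_ w (V q)
    ... | yes w∈q with path-through-neighbour (Adj-sym e) q uq w∈q
    ...   | q′ , eq , uq′ = trans (cong (u ∷_) (path-unique p q′ up′ uq′)) (sym eq)
    -- Stepping from `w` back to `u` and following `q` is then a second path from `w`; by induction
    -- it has the vertices of `p`, which puts `u` on `p`.
    path-unique {u} (_◅_ {j = w} e p) q@(_ ◅ _) up uq | u∉p , up′ | no w∉q =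
      contradiction
        (subst (u ∈ₗ_)
          (sym (path-unique p (Adj-sym e ◅ q) up′ (∷-unique⁺ w∉q uq)))
          (there (source∈ q)))
        u∉p

-- The intervals of a tree satisfy S, T and U₁.

module TreeIntervals (T : Tree n) where
  open Tree T
  open SimpleGraph graph using () renaming (sym to Adj-sym)
  open Walks graph

  private
    V : ∀ {u v} → Walk graph u v → List (Fin n)
    V = vertices graph

    J : Fin n → Fin n → Subset n
    J = interval T

  -- By uniqueness of paths, any path may stand in for the one that `connected` supplies.
  ∈-interval⁺ : ∀ {a b x} (p : Walk graph a b) → Unique (V p) → x ∈ₗ V p → x ∈ J a b
  ∈-interval⁺ {a} {b} p up x∈ = ∈-⋃-singletons⁺
    (subst (_ ∈ₗ_) (path-unique acyclic p _ up (proj₂ (connected a b))) x∈)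

  ∈-interval⁻ : ∀ {a b x} (p : Walk graph a b) → Unique (V p) → x ∈ J a b → x ∈ₗ V p
  ∈-interval⁻ {a} {b} p up x∈ =
    subst (_ ∈ₗ_) (path-unique acyclic _ p (proj₂ (connected a b)) up) (∈-⋃-singletons⁻ _ x∈)

  left∈ : ∀ a b → a ∈ J a b
  left∈ a b = ∈-interval⁺ _ (proj₂ (connected a b)) (source∈ _)

  right∈ : ∀ a b → b ∈ J a b
  right∈ a b = ∈-interval⁺ _ (proj₂ (connected a b)) (target∈ (proj₁ (connected a b)))

  split-interval : ∀ {a b c} → b ∈ J a c →
                   (∀ {x} → x ∈ J a b → x ∈ J b c → x ≡ b) × J b c ⊆ J a c
  split-interval {a} {b} {c} b∈ = go (proj₁ (connected a c)) (proj₂ (connected a c))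
    where
    -- The path is a variable here, so that matching on `refl` can replace it by `r ◅◅ s`.
    go : (p : Walk graph a c) → Unique (V p) →
         (∀ {x} → x ∈ J a b → x ∈ J b c → x ≡ b) × J b c ⊆ J a c
    go p up with splitAt p (∈-interval⁻ p up b∈)
    ... | r , s , refl with ◅◅-unique⁻ r s up
    ... | ur , us , meet =
      (λ x∈ab x∈bc → meet (∈-interval⁻ r ur x∈ab) (∈-interval⁻ s us x∈bc)) ,
      (λ x∈bc → ∈-interval⁺ (r ◅◅ s) up (∈-◅◅⁺ʳ r s (∈-interval⁻ s us x∈bc)))

  interval-∪ : ∀ {a b c} → (∀ {x} → x ∈ J a b → x ∈ J b c → x ≡ b) → J a b ∪ J b c ≡ J a c
  interval-∪ {a} {b} {c} meet = ⊆-antisym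
    (λ x∈ → ∈-interval⁺ (p ◅◅ q) upq
      ([ ∈-◅◅⁺ˡ p q ∘ ∈-interval⁻ p up , ∈-◅◅⁺ʳ p q ∘ ∈-interval⁻ q uq ]′ (x∈p∪q⁻ _ _ x∈)))
    (λ x∈ → x∈p∪q⁺ ([ inj₁ ∘ ∈-interval⁺ p up , inj₂ ∘ ∈-interval⁺ q uq ]′
      (∈-◅◅⁻ p q (∈-interval⁻ (p ◅◅ q) upq x∈))))
    where
    p  = proj₁ (connected a b)
    up = proj₂ (connected a b)
    q  = proj₁ (connected b c)
    uq = proj₂ (connected b c)
    upq = ◅◅-unique⁺ p q up uq
      (λ y∈p y∈q → meet (∈-interval⁺ p up y∈p) (∈-interval⁺ q uq y∈q))

  -- Yields the symmetry of intervals without reversing walks: by induction `J b w` is the vertex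
  -- set of the tail, and `interval-∪` appends the edge from `w` to `a` at its far end.
  path⇒interval-reverse : ∀ {a b x} (p : Walk graph a b) → Unique (V p) →
                          (x ∈ₗ V p → x ∈ J b a) × (x ∈ J b a → x ∈ₗ V p)
  path⇒interval-reverse ε up = ∈-interval⁺ ε up , ∈-interval⁻ ε up
  path⇒interval-reverse {a} {b} {x} (_◅_ {j = w} e p) up with ∷-unique⁻ up
  ... | a∉p , up′ = to , from
    where
    rev : ∀ {y} → (y ∈ₗ V p → y ∈ J b w) × (y ∈ J b w → y ∈ₗ V p)
    rev = path⇒interval-reverse p up′

    edge : Walk graph w a
    edge = Adj-sym e ◅ ε

    edge-unique : Unique (V edge)
    edge-unique = ∷-unique⁺ (λ { (here refl) → a∉p (source∈ p) }) (∷-unique⁺ (λ ()) [])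

    meet : ∀ {y} → y ∈ J b w → y ∈ J w a → y ≡ w
    meet y∈bw y∈wa with ∈-interval⁻ edge edge-unique y∈wa
    ... | here y≡w         = y≡w
    ... | there (here refl) = contradiction (proj₂ rev y∈bw) a∉p

    to : x ∈ₗ a ∷ V p → x ∈ J b a
    to (here refl) = right∈ b a
    to (there x∈p) = subst (x ∈_) (interval-∪ meet) (x∈p∪q⁺ (inj₁ (proj₁ rev x∈p)))

    from : x ∈ J b a → x ∈ₗ a ∷ V p
    from x∈ba with x∈p∪q⁻ _ _ (subst (x ∈_) (sym (interval-∪ meet)) x∈ba)
    ... | inj₁ x∈bw = there (proj₂ rev x∈bw)
    ... | inj₂ x∈wa with ∈-interval⁻ edge edge-unique x∈wa
    ...   | here refl         = there (source∈ p)
    ...   | there (here refl) = here refl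

  interval-sym : ∀ a b → J a b ⊆ J b a
  interval-sym a b = proj₁ (path⇒interval-reverse _ up) ∘ ∈-interval⁻ _ up
    where up = proj₂ (connected a b)

  -- The first vertex of `p` on `J b c` serves as `d`; vertices before it lie outside `J b c`, so
  -- dropping them leaves the intersection unchanged.
  gate : ∀ {a b} c (p : Walk graph a b) → Unique (V p) → ∃[ d ] J a b ∩ J b c ≡ J b d
  gate {a} {b} c p up with a ∈? J b c
  ... | yes a∈bc = a , ⊆-antisym
    (λ x∈ → interval-sym a b (proj₁ (x∈p∩q⁻ _ _ x∈)))
    -- `split-interval` gives inclusion for final segments only, so `J b a ⊆ J b c` is obtained by
    -- reversing all intervals.
    (λ x∈ba → x∈p∩q⁺ (interval-sym b a x∈ba , interval-sym c b
      (proj₂ (split-interval (interval-sym b c a∈bc)) (interval-sym b a x∈ba))))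
  gate {a} c ε up | no a∉ = contradiction (left∈ a c) a∉
  gate {a} {b} c (_◅_ {j = w} e p) up | no a∉bc with gate c p (proj₂ (∷-unique⁻ up))
  ... | d , eq = d , trans (⊆-antisym drop-a add-a) eq
    where
    drop-a : J a b ∩ J b c ⊆ J w b ∩ J b c
    drop-a x∈ with x∈p∩q⁻ _ _ x∈
    ... | x∈ab , x∈bc with ∈-interval⁻ (e ◅ p) up x∈ab
    ...   | here refl = contradiction x∈bc a∉bc
    ...   | there x∈p = x∈p∩q⁺ (∈-interval⁺ p (proj₂ (∷-unique⁻ up)) x∈p , x∈bc)

    add-a : J w b ∩ J b c ⊆ J a b ∩ J b c
    add-a x∈ with x∈p∩q⁻ _ _ x∈
    ... | x∈wb , x∈bc = x∈p∩q⁺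
      (∈-interval⁺ (e ◅ p) up (there (∈-interval⁻ p (proj₂ (∷-unique⁻ up)) x∈wb)) , x∈bc)

  interval-S : ConditionS J
  interval-S a b c = gate c (proj₁ (connected a b)) (proj₂ (connected a b))

  interval-T : ConditionT J
  interval-T a b c ab⊆ac =
    ∩≡⁅⁆⁺ (right∈ a b) (left∈ b c) (proj₁ (split-interval (ab⊆ac (right∈ a b))))

  interval-U₁ : ConditionU₁ J
  interval-U₁ a b c eq = interval-∪ (∩≡⁅⁆⁻ eq)

-- Transport of the conditions along pointwise equality.

module _ {I J : Fin n → Fin n → Subset n} (J≡I : ∀ a b → J a b ≡ I a b) where

  ConditionS-resp : ConditionS J → ConditionS I
  ConditionS-resp S a b c with S a b c
  ... | d , eq rewrite J≡I a b | J≡I b c | J≡I b d = d , eq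

  ConditionT-resp : ConditionT J → ConditionT I
  ConditionT-resp T a b c rewrite sym (J≡I a b) | sym (J≡I b c) | sym (J≡I a c) = T a b c

  ConditionU₁-resp : ConditionU₁ J → ConditionU₁ I
  ConditionU₁-resp U a b c rewrite sym (J≡I a b) | sym (J≡I b c) | sym (J≡I a c) = U a b c

-- Consequences of S, T and U₁: endpoints, symmetry and splitting.

module IntervalTree (I : Fin n → Fin n → Subset n)
  (S : ConditionS I) (T : ConditionT I) (U₁ : ConditionU₁ I) where

  -- The hypothesis of T is trivial for `c = b`, and its conclusion has `b` on the right.
  right∈ : ∀ a b → b ∈ I a b
  right∈ a b = proj₁ (x∈p∩q⁻ (I a b) (I b b) (subst (b ∈_) (sym (T a b b (λ x → x))) (x∈⁅x⁆ b)))

  ∈-refl⁻ : ∀ {a x} → x ∈ I a a → x ≡ a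
  ∈-refl⁻ {a} x∈ = ∩≡⁅⁆⁻ (T a a a (λ x → x)) x∈ x∈

  module _ (a b c : Fin n) where

    meet : Fin n
    meet = proj₁ (S a b c)

    ∈-meet⁺ : ∀ {x} → x ∈ I a b → x ∈ I b c → x ∈ I b meet
    ∈-meet⁺ x∈ab x∈bc = subst (_ ∈_) (proj₂ (S a b c)) (x∈p∩q⁺ (x∈ab , x∈bc))

    ∈-meet⁻ : ∀ {x} → x ∈ I b meet → x ∈ I a b × x ∈ I b c
    ∈-meet⁻ x∈ = x∈p∩q⁻ _ _ (subst (_ ∈_) (sym (proj₂ (S a b c))) x∈)

  -- S gives `I a a ∩ I a b ≡ I a d`; this contains `d`, and `I a a` has no element but `a`.
  left∈ : ∀ a b → a ∈ I a b
  left∈ a b with ∈-meet⁻ a a b (right∈ a (meet a a b))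
  ... | d∈aa , d∈ab = subst (_∈ I a b) (∈-refl⁻ d∈aa) d∈ab

  -- S gives `I a b ∩ I b a ≡ I b d`. As `I b d ⊆ I b a`, T makes `d` the only common element of
  -- `I b d` and `I d a`; but `a` lies in both, so `d` is `a`.
  I-sym : ∀ a b → I b a ⊆ I a b
  I-sym a b x∈ba = proj₁ (∈-meet⁻ a b a (subst (λ e → _ ∈ I b e) a≡d x∈ba))
    where
    d = meet a b a

    a≡d : a ≡ d
    a≡d = ∩≡⁅⁆⁻ (T b d a (proj₂ ∘ ∈-meet⁻ a b a))
                (∈-meet⁺ a b a (left∈ a b) (right∈ b a)) (right∈ d a)

  -- The argument of `I-sym` again, with `I b a ∩ I a d ≡ I a e`: T forces `e` to be `d`.
  I-prefix : ∀ {a b d} → d ∈ I a b → I a d ⊆ I a b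
  I-prefix {a} {b} {d} d∈ab x∈ad =
    I-sym a b (proj₁ (∈-meet⁻ b a d (subst (λ e → _ ∈ I a e) d≡e x∈ad)))
    where
    e = meet b a d

    d≡e : d ≡ e
    d≡e = ∩≡⁅⁆⁻ (T a e d (proj₂ ∘ ∈-meet⁻ b a d))
                (∈-meet⁺ b a d (I-sym b a d∈ab) (right∈ a d)) (right∈ e d)

  I-split-∩ : ∀ {a b d} → d ∈ I a b → I a d ∩ I d b ≡ ⁅ d ⁆
  I-split-∩ {a} {b} {d} d∈ab = T a d b (I-prefix d∈ab)

  I-split-∪ : ∀ {a b d} → d ∈ I a b → I a d ∪ I d b ≡ I a b
  I-split-∪ {a} {b} {d} d∈ab = U₁ a d b (I-split-∩ d∈ab)

  I-suffix : ∀ {a b d} → d ∈ I a b → I d b ⊆ I a b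
  I-suffix {a} {b} d∈ab x∈db = subst (_ ∈_) (I-split-∪ d∈ab) (x∈p∪q⁺ (inj₂ x∈db))

  -- The graph of `I` and its paths.

  IAdj : Fin n → Fin n → Set
  IAdj u v = u ≢ v × (∀ x → x ∈ I u v → x ≡ u ⊎ x ≡ v)

  intervalGraph : SimpleGraph n
  intervalGraph = record
    { Adj    = IAdj
    ; adj?   = λ u v → ¬? (u ≟ v) ×-dec
                 all? (λ x → (x ∈? I u v) →-dec ((x ≟ u) ⊎-dec (x ≟ v)))
    ; sym    = λ {u} {v} (u≢v , only) → u≢v ∘ sym , λ x x∈vu →
                 [ inj₂ , inj₁ ]′ (only x (I-sym u v x∈vu))
    ; irrefl = λ u≡v (u≢v , _) → u≢v u≡v
    }

  open Walks intervalGraph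

  private
    V : ∀ {u v} → Walk intervalGraph u v → List (Fin n)
    V = vertices intervalGraph

  I-cons : ∀ {u w v} → IAdj u w → w ∈ I u v → ∀ {x} → x ∈ I u v → x ≡ u ⊎ x ∈ I w v
  I-cons {u} {w} {v} (_ , only) w∈uv {x} x∈uv
    with x∈p∪q⁻ _ _ (subst (x ∈_) (sym (I-split-∪ w∈uv)) x∈uv)
  ... | inj₂ x∈wv = inj₂ x∈wv
  ... | inj₁ x∈uw with only x x∈uw
  ...   | inj₁ x≡u  = inj₁ x≡u
  ...   | inj₂ refl = inj₂ (left∈ w v)

  -- If some `x` lies strictly between `u` and `v`, the search goes on in `I u x`, which is strictly
  -- smaller because it misses `v`; otherwise `v` itself is adjacent to `u`.
  first-step : ∀ {u v} → Acc _⊂_ (I u v) → u ≢ v → ∃[ w ] IAdj u w × w ∈ I u v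
  first-step {u} {v} (acc rec) u≢v
    with any? (λ x → (x ∈? I u v) ×-dec (¬? (x ≟ u) ×-dec ¬? (x ≟ v)))
  ... | yes (x , x∈uv , x≢u , x≢v)
      with first-step (rec (I-prefix x∈uv , v , right∈ u v ,
             λ v∈ux → x≢v (sym (∩≡⁅⁆⁻ (I-split-∩ x∈uv) v∈ux (right∈ x v)))))
           (x≢u ∘ sym)
  ...   | w , adj , w∈ux = w , adj , I-prefix x∈uv w∈ux
  first-step {u} {v} (acc rec) u≢v | no none = v , (u≢v , only) , right∈ u v
    where
    only : ∀ x → x ∈ I u v → x ≡ u ⊎ x ≡ v
    only x x∈uv with x ≟ u | x ≟ v
    ... | yes x≡u | _       = inj₁ x≡u
    ... | no _    | yes x≡v = inj₂ x≡v
    ... | no x≢u  | no x≢v  = contradiction (x , x∈uv , x≢u , x≢v) none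

  -- Containment in the interval is carried through the recursion because it keeps the path simple:
  -- `u` is not in `I w v`, hence not on the rest of the path.
  path-within : ∀ {u v} → Acc _⊂_ (I u v) →
                Σ (Walk intervalGraph u v) λ p → Unique (V p) × (∀ {x} → x ∈ₗ V p → x ∈ I u v)
  path-within {u} {v} wf@(acc rec) with u ≟ v
  ... | yes refl = ε , ∷-unique⁺ (λ ()) [] , λ { (here refl) → left∈ u u }
  ... | no u≢v with first-step wf u≢v
  ... | w , adj , w∈uv = result
    where
    u∉wv : ¬ u ∈ I w v
    u∉wv u∈wv = proj₁ adj (∩≡⁅⁆⁻ (I-split-∩ w∈uv) (left∈ u w) u∈wv)

    result : Σ (Walk intervalGraph u v) λ p → Unique (V p) × (∀ {x} → x ∈ₗ V p → x ∈ I u v)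
    result with path-within (rec (I-suffix w∈uv , u , left∈ u v , u∉wv))
    ... | p , up , p⊆wv = adj ◅ p , ∷-unique⁺ (u∉wv ∘ p⊆wv) up ,
      λ { (here refl) → left∈ u v ; (there x∈p) → I-suffix w∈uv (p⊆wv x∈p) }

  -- `I u w` contains only `u` and `w`, while `I w v` is by induction the vertex set of the tail and
  -- misses `u`. They meet in `w` alone, so U₁ applies.
  path≡I : ∀ {u v} (p : Walk intervalGraph u v) → Unique (V p) → ⋃ (map ⁅_⁆ (V p)) ≡ I u v
  path≡I {u} ε _ = trans (∪-identityʳ ⁅ u ⁆) (trans (sym (T u u u (λ x → x))) (∩-idem (I u u)))
  path≡I {u} {v} (_◅_ {j = w} adj p) up with ∷-unique⁻ up
  ... | u∉p , up′ = ⊆-antisym (to ∘ ∈-⋃-singletons⁻ (u ∷ V p)) from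
    where
    p≡wv : ⋃ (map ⁅_⁆ (V p)) ≡ I w v
    p≡wv = path≡I p up′

    meet≡w : ∀ {x} → x ∈ I u w → x ∈ I w v → x ≡ w
    meet≡w {x} x∈uw x∈wv with proj₂ adj x x∈uw
    ... | inj₂ x≡w  = x≡w
    ... | inj₁ refl =
      contradiction (∈-⋃-singletons⁻ _ (subst (x ∈_) (sym p≡wv) x∈wv)) u∉p

    uw∪wv≡uv : I u w ∪ I w v ≡ I u v
    uw∪wv≡uv = U₁ u w v (∩≡⁅⁆⁺ (right∈ u w) (left∈ w v) meet≡w)

    w∈uv : w ∈ I u v
    w∈uv = subst (w ∈_) uw∪wv≡uv (x∈p∪q⁺ (inj₁ (right∈ u w)))

    to : ∀ {x} → x ∈ₗ u ∷ V p → x ∈ I u v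
    to (here refl) = left∈ u v
    to (there x∈p) = I-suffix w∈uv (subst (_ ∈_) p≡wv (∈-⋃-singletons⁺ {xs = V p} x∈p))

    from : I u v ⊆ ⋃ (map ⁅_⁆ (u ∷ V p))
    from x∈uv with I-cons adj w∈uv x∈uv
    ... | inj₁ refl = x∈p∪q⁺ (inj₁ (x∈⁅x⁆ u))
    ... | inj₂ x∈wv = x∈p∪q⁺ (inj₂ (subst (_ ∈_) (sym p≡wv) x∈wv))

  -- The second vertex of the path lies in `I u v` by `path≡I`. The closing edge leaves only `u` and
  -- `v` there, and either choice repeats a vertex.
  intervalGraph-acyclic : Acyclic intervalGraph
  intervalGraph-acyclic (u , v , (ε , _) , s≤s () , _)
  intervalGraph-acyclic (u , v , (_ ◅ ε , _) , s≤s (s≤s ()) , _)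
  intervalGraph-acyclic (u , v , (e ◅ f ◅ p , up) , _ , v-u) with ∷-unique⁻ up
  ... | u∉ , up′ with proj₂ (SimpleGraph.sym intervalGraph v-u) _
                        (subst (_ ∈_) (path≡I (e ◅ f ◅ p) up)
                          (∈-⋃-singletons⁺ {xs = V (e ◅ f ◅ p)} (there (here refl))))
  ...   | inj₁ refl = u∉ (here refl)
  ...   | inj₂ refl = proj₁ (∷-unique⁻ up′) (target∈ p)

  intervalTree : Tree n
  intervalTree = record
    { graph     = intervalGraph
    ; connected = λ u v → let p , up , _ = path-within (⊂-wellFounded (I u v)) in p , up
    ; acyclic   = intervalGraph-acyclic
    }

  interval≡I : ∀ u v → interval intervalTree u v ≡ I u v
  interval≡I u v = let p , up = Tree.connected intervalTree u v in path≡I p up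

theorem1 : ∀ (n : ℕ) (I : Fin n → Fin n → Subset n) →
    (ConditionS I × ConditionT I × ConditionU₁ I) ⇔
    (Σ (Tree n) λ T → ∀ v w → interval T v w ≡ I v w)
theorem1 n I = mk⇔
  (λ (S , T , U₁) → IntervalTree.intervalTree I S T U₁ , IntervalTree.interval≡I I S T U₁)
  (λ (T , eq) → let open TreeIntervals T in
    ConditionS-resp eq interval-S , ConditionT-resp eq interval-T , ConditionU₁-resp eq interval-U₁)
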